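{- Let $\mathcal{P}=(A,\mathsf{P})$ be an FPARS and suppose there is a (non-negative) Lyapunov function for it, i.e. a function $V:A\to\mathbb{R}$ with $V(a)\ge 0$ for all $a\in A$ and a real $\varepsilon>0$ such that for every $a\in A$, if $\mathsf{P}(a)=\mu$ then $V(a)\ge V(\mu)+\varepsilon$, where $V(\mu)=\sum_{b\in A}V(b)\,\mu(b)$. Then $\mathcal{P}$ is positive almost-surely terminating (PAST), and for every $a\in A$ the average derivation length of the computation starting from $a$ satisfies $$\mathsf{Steps}_{\mathsf{P}}(a)\le\frac{V(a)}{\varepsilon}.$$
   Context: An abstract reduction system (ARS) is a pair $(A,\to)$ with $A$ at most countable and $\to\,\subseteq A\times A$; $a\in A$ is in normal form if there is no $b$ with $a\to b$. A randomised reduction strategy for $(A,\to)$ is a partial function $\mathsf{P}$ from $A$ to probability distributions on $A$ such that $\mathsf{P}(a)$ is undefined iff $a$ is in normal form, and if $\mathsf{P}(a)=\mu$ then $\mu(b)>0$ implies $a\to b$. The pair $(A,\mathsf{P})$ is called a fully probabilistic abstract reduction system (FPARS). Put $\mathbb{P}(a\to b)=\mu(b)$ if $\mathsf{P}(a)=\mu$, and $\mathbb{P}(a\to b)=0$ if $\mathsf{P}(a)$ is undefined. For $a\in A$, the computation starting from $a$ is the sequence of partial distributions $(\rho_i)_{i\in\mathbb{N}}$ with $\rho_0$ the Dirac distribution at $a$ and $\rho_{i+1}(c)=\sum_{b\in A}\rho_i(b)\,\mathbb{P}(b\to c)$. Write $|\rho|=\sum_{b}\rho(b)$ and $\mathsf{Steps}_{\mathsf{P}}(a)=\sum_{i=1}^\infty|\rho_i|\in[0,+\infty]$.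 The FPARS is PAST if $\mathsf{Steps}_{\mathsf{P}}(a)<+\infty$ for every $a\in A$. The sum $V(\mu)$ of non-negative terms is taken in $[0,+\infty]$. -}

module Defs where

open import Data.Empty using (⊥)
open import Data.List.Base using (List; []; foldr; map)
open import Data.List.Relation.Unary.Unique.Propositional using (Unique; [])
open import Data.Maybe.Base using (Maybe; just; nothing; maybe′)
open import Data.Nat.Base using (ℕ; zero; suc)
import Data.Nat.Properties as ℕ
open import Data.Product.Base using (Σ-syntax; ∃; ∃-syntax; _×_; _,_)
open import Data.Rational.Base as ℚ using (ℚ; 0ℚ; 1ℚ; ½)
import Data.Rational.Properties as ℚ
open import Data.Sum.Base using (_⊎_; inj₁; inj₂)
open import Data.Bool.Base using (if_then_else_)
open import Function.Bundles using (_↣_; _⇔_)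
open import Relation.Binary.Core using (Rel)
open import Relation.Binary.Definitions using (DecidableEquality)
open import Relation.Binary.PropositionalEquality.Core using (_≡_; sym; trans; subst)
open import Relation.Binary.Rewriting using (IsNormalForm)
open import Relation.Nullary.Decidable using (does; via-injection)
open import Relation.Nullary.Negation.Core using (¬_)
open import Level using (0ℓ)

-- Real numbers, as two-sided Dedekind cuts of ℚ:
-- lower q means q < x, and upper q means x < q.

record ℝ : Set₁ where
  field
    lower upper     : ℚ → Set
    lower-inhabited : ∃ lower
    upper-inhabited : ∃ upper
    lower-closed    : ∀ {q r} → q ℚ.< r → lower r → lower q
    upper-closed    : ∀ {q r} → q ℚ.< r → upper q → upper r
    lower-open      : ∀ {q} → lower q → ∃[ r ] (q ℚ.< r × lower r)
    upper-open      : ∀ {r} → upper r → ∃[ q ] (q ℚ.< r × upper q)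
    disjoint        : ∀ {q} → lower q → upper q → ⊥
    located         : ∀ {q r} → q ℚ.< r → lower q ⊎ upper r

open ℝ public

NonNegative : ℝ → Set
NonNegative x = ∀ {q} → q ℚ.< 0ℚ → lower x q

Positive : ℝ → Set
Positive x = lower x 0ℚ

Positive⇒NonNegative : ∀ x → Positive x → NonNegative x
Positive⇒NonNegative x 0<x q<0 = lower-closed x q<0 0<x

-- The extended half-line [0,+∞], as (possibly unbounded) lower cuts of ℚ;
-- below x q means q < x, and +∞ is the cut containing every rational.

record ℝ≥0∞ : Set₁ where
  field
    below          : ℚ → Set
    below-negative : ∀ {q} → q ℚ.< 0ℚ → below q
    below-closed   : ∀ {q r} → q ℚ.< r → below r → below q
    below-open     : ∀ {q} → below q → ∃[ r ] (q ℚ.< r × below r)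

open ℝ≥0∞ public

infix 4 _≤_ _≥_ _≈_
infixl 6 _+_
infixl 7 _*_ _/_

_≤_ _≥_ _≈_ : ℝ≥0∞ → ℝ≥0∞ → Set
x ≤ y = ∀ {q} → below x q → below y q
x ≥ y = y ≤ x
x ≈ y = x ≤ y × y ≤ x

Finite : ℝ≥0∞ → Set
Finite x = ∃[ r ] (∀ {q} → below x q → q ℚ.< r)

fromℝ : (x : ℝ) → NonNegative x → ℝ≥0∞
fromℝ x 0≤x = record
  { below          = lower x
  ; below-negative = 0≤x
  ; below-closed   = lower-closed x
  ; below-open     = lower-open x
  }

fromℚ : (p : ℚ) → 0ℚ ℚ.≤ p → ℝ≥0∞
fromℚ p 0≤p = record
  { below          = ℚ._< p
  ; below-negative = λ q<0 → ℚ.<-≤-trans q<0 0≤p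
  ; below-closed   = ℚ.<-trans
  ; below-open     = ℚ.<-dense
  }

0∞ 1∞ : ℝ≥0∞
0∞ = fromℚ 0ℚ ℚ.≤-refl
1∞ = fromℚ 1ℚ (ℚ.nonNegative⁻¹ 1ℚ)

private
  ½+½ : ∀ m → ½ ℚ.* m ℚ.+ ½ ℚ.* m ≡ m
  ½+½ m = trans (sym (ℚ.*-distribʳ-+ m ½ ½)) (ℚ.*-identityˡ m)

  ½-negative : ∀ {m} → m ℚ.< 0ℚ → ½ ℚ.* m ℚ.< 0ℚ
  ½-negative {m} m<0 =
    subst (½ ℚ.* m ℚ.<_) (ℚ.*-zeroʳ ½) (ℚ.*-monoʳ-<-pos ½ m<0)

_+_ : ℝ≥0∞ → ℝ≥0∞ → ℝ≥0∞
x + y = record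
  { below          = λ q → ∃[ s ] ∃[ t ] (below x s × below y t × q ℚ.< s ℚ.+ t)
  ; below-negative = λ {q} q<0 →
      let m , q<m , m<0 = ℚ.<-dense q<0
      in  ½ ℚ.* m , ½ ℚ.* m
        , below-negative x (½-negative m<0)
        , below-negative y (½-negative m<0)
        , subst (q ℚ.<_) (sym (½+½ m)) q<m
  ; below-closed   = λ where
      q<r (s , t , s<x , t<y , r<s+t) → s , t , s<x , t<y , ℚ.<-trans q<r r<s+t
  ; below-open     = λ where
      (s , t , s<x , t<y , q<s+t) →
        let m , q<m , m<s+t = ℚ.<-dense q<s+t
        in  m , q<m , s , t , s<x , t<y , m<s+t
  }

-- With s and t required non-negative, 0 · ∞ = 0.

_*_ : ℝ≥0∞ → ℝ≥0∞ → ℝ≥0∞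
x * y = record
  { below          = λ q → q ℚ.< 0ℚ ⊎
      (∃[ s ] ∃[ t ] (0ℚ ℚ.≤ s × 0ℚ ℚ.≤ t × below x s × below y t × q ℚ.< s ℚ.* t))
  ; below-negative = inj₁
  ; below-closed   = λ where
      q<r (inj₁ r<0) → inj₁ (ℚ.<-trans q<r r<0)
      q<r (inj₂ (s , t , 0≤s , 0≤t , s<x , t<y , r<st)) →
        inj₂ (s , t , 0≤s , 0≤t , s<x , t<y , ℚ.<-trans q<r r<st)
  ; below-open     = λ where
      (inj₁ q<0) →
        let m , q<m , m<0 = ℚ.<-dense q<0 in m , q<m , inj₁ m<0
      (inj₂ (s , t , 0≤s , 0≤t , s<x , t<y , q<st)) →
        let m , q<m , m<st = ℚ.<-dense q<st
        in  m , q<m , inj₂ (s , t , 0≤s , 0≤t , s<x , t<y , m<st)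
  }

-- q < x / ε iff there are r > q and u > ε with r · u < x.

_/_ : ℝ≥0∞ → Σ[ ε ∈ ℝ ] Positive ε → ℝ≥0∞
x / (ε , 0<ε) = record
  { below          = λ q → ∃[ r ] ∃[ u ] (q ℚ.< r × upper ε u × below x (r ℚ.* u))
  ; below-negative = λ q<0 →
      let r , q<r , r<0 = ℚ.<-dense q<0
          u , ε<u       = upper-inhabited ε
      in  r , u , q<r , ε<u , below-negative x (neg*pos r<0 (0<u ε<u))
  ; below-closed   = λ where
      q<q′ (r , u , q′<r , ε<u , ru<x) → r , u , ℚ.<-trans q<q′ q′<r , ε<u , ru<x
  ; below-open     = λ where
      (r , u , q<r , ε<u , ru<x) →
        let m , q<m , m<r = ℚ.<-dense q<r
        in  m , q<m , r , u , m<r , ε<u , ru<x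
  }
  where
  open import Relation.Binary.Definitions using (tri<; tri≈; tri>)
  open import Relation.Nullary.Negation.Core using (contradiction)

  0<u : ∀ {u} → upper ε u → 0ℚ ℚ.< u
  0<u {u} ε<u with ℚ.<-cmp 0ℚ u
  ... | tri< 0<u _ _ = 0<u
  ... | tri≈ _ 0≡u _ = contradiction ε<u (disjoint ε (subst (lower ε) 0≡u 0<ε))
  ... | tri> _ _ u<0 = contradiction ε<u (disjoint ε (lower-closed ε u<0 0<ε))

  neg*pos : ∀ {r u} → r ℚ.< 0ℚ → 0ℚ ℚ.< u → r ℚ.* u ℚ.< 0ℚ
  neg*pos {r} {u} r<0 0<u =
    subst (r ℚ.* u ℚ.<_) (ℚ.*-zeroˡ u)
      (ℚ.*-monoˡ-<-pos u {{ℚ.positive 0<u}} r<0)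

-- The sum of a family, as the supremum of its sums over finite subsets
-- (given by duplicate-free lists).

finiteSum : List ℝ≥0∞ → ℝ≥0∞
finiteSum = foldr _+_ 0∞

∑ : {A : Set} → (A → ℝ≥0∞) → ℝ≥0∞
∑ {A} f = record
  { below          = λ q → ∃[ xs ] (Unique xs × below (finiteSum (map f xs)) q)
  ; below-negative = λ q<0 → [] , [] , q<0
  ; below-closed   = λ where
      q<r (xs , u , r<∑) → xs , u , below-closed (finiteSum (map f xs)) q<r r<∑
  ; below-open     = λ where
      (xs , u , q<∑) →
        let r , q<r , r<∑ = below-open (finiteSum (map f xs)) q<∑
        in  r , q<r , xs , u , r<∑
  }

-- The sum of a series, as the supremum of its partial sums.

partialSum : (ℕ → ℝ≥0∞) → ℕ → ℝ≥0∞
partialSum f zero    = 0∞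
partialSum f (suc n) = partialSum f n + f n

series : (ℕ → ℝ≥0∞) → ℝ≥0∞
series f = record
  { below          = λ q → ∃[ n ] below (partialSum f n) q
  ; below-negative = λ q<0 → zero , q<0
  ; below-closed   = λ where
      q<r (n , r<∑) → n , below-closed (partialSum f n) q<r r<∑
  ; below-open     = λ where
      (n , q<∑) →
        let r , q<r , r<∑ = below-open (partialSum f n) q<∑ in r , q<r , n , r<∑
  }

record ARS : Set₁ where
  field
    Carrier   : Set
    countable : Carrier ↣ ℕ
    _⟶_       : Rel Carrier 0ℓ

  _≟_ : DecidableEquality Carrier
  _≟_ = via-injection countable ℕ._≟_

record Distribution (A : Set) : Set₁ where
  field
    prob        : A → ℝ
    nonNegative : ∀ b → NonNegative (prob b)

  mass : A → ℝ≥0∞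
  mass b = fromℝ (prob b) (nonNegative b)

  field
    total : ∑ mass ≈ 1∞

open Distribution public

record FPARS : Set₁ where
  field
    ars : ARS

  open ARS ars public

  field
    P           : Carrier → Maybe (Distribution Carrier)
    P-undefined : ∀ a → P a ≡ nothing ⇔ IsNormalForm _⟶_ a
    P-support   : ∀ {a μ} → P a ≡ just μ → ∀ {b} → Positive (prob μ b) → a ⟶ b

  ℙ[_⟶_] : Carrier → Carrier → ℝ≥0∞
  ℙ[ a ⟶ b ] = maybe′ (λ μ → mass μ b) 0∞ (P a)

  dirac : Carrier → Carrier → ℝ≥0∞
  dirac a b = if does (a ≟ b) then 1∞ else 0∞

  ρ : Carrier → ℕ → Carrier → ℝ≥0∞
  ρ a zero    = dirac a
  ρ a (suc i) = λ c → ∑ (λ b → ρ a i b * ℙ[ b ⟶ c ])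

  ∣_∣ : (Carrier → ℝ≥0∞) → ℝ≥0∞
  ∣ σ ∣ = ∑ σ

  -- The series starts at i = 1, hence the shift.
  Steps : Carrier → ℝ≥0∞
  Steps a = series (λ i → ∣ ρ a (suc i) ∣)

  PAST : Set
  PAST = ∀ a → Finite (Steps a)

  record Lyapunov : Set₁ where
    field
      V     : Carrier → ℝ
      V≥0   : ∀ a → NonNegative (V a)
      ε     : ℝ
      ε>0   : Positive ε

    V∞ : Carrier → ℝ≥0∞
    V∞ a = fromℝ (V a) (V≥0 a)

    ε∞ : ℝ≥0∞
    ε∞ = fromℝ ε (Positive⇒NonNegative ε ε>0)

    V⟨_⟩ : Distribution Carrier → ℝ≥0∞
    V⟨ μ ⟩ = ∑ (λ b → V∞ b * mass μ b)

    field
      decrease : ∀ {a μ} → P a ≡ just μ → V∞ a ≥ V⟨ μ ⟩ + ε∞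

{-# OPTIONS --safe #-}
module Submission where

-- Let Φ i = ∑ b, ρ i b · V b be the expected value of V after i steps.  The Lyapunov
-- condition, averaged over ρ i (Tonelli), gives Φ (i + 1) + ε · ∣ρ (i + 1)∣ ≤ Φ i: terminal
-- elements contribute nothing on the left.  Since Φ 0 = V a, telescoping yields
-- ε · ∑_{1 ≤ i ≤ n} ∣ρ i∣ ≤ V a for all n.  All of this needs only inequalities between lower
-- cuts; the division by ε uses in addition that ε is located, to get rationals e < ε < u
-- with u / e arbitrarily close to 1.

open import Defs
open import Data.Bool.Base using (if_then_else_)
open import Data.Empty using (⊥-elim)
import Data.Integer.Base as ℤ
import Data.Integer.Properties as ℤ
open import Data.List.Base using (List; []; _∷_; _++_; foldr; map; deduplicate)
open import Data.List.Membership.Propositional using (_∈_; _∉_)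
open import Data.List.Membership.Propositional.Properties
  using (∈-∃++; ∈-++⁺ˡ; ∈-++⁺ʳ; ∈-++⁻; ∈-deduplicate⁺)
import Data.List.Relation.Unary.All as All
open import Data.List.Relation.Unary.AllPairs.Core using ([]; _∷_)
open import Data.List.Relation.Unary.Any using (here; there)
open import Data.List.Relation.Unary.Unique.Propositional using (Unique)
open import Data.List.Relation.Unary.Unique.Propositional.Properties using (Unique[x∷xs]⇒x∉xs)
import Data.List.Relation.Unary.Unique.DecPropositional.Properties as Unique
open import Data.Maybe.Base using (just; nothing; maybe′)
open import Data.Nat.Base using (ℕ; zero; suc)
import Data.Nat.Coprimality as Coprime
import Data.Nat.Properties as ℕ
open import Data.Product.Base using (∃-syntax; _×_; _,_; proj₁; proj₂)
open import Data.Rational.Base as ℚ using (ℚ; 0ℚ; 1ℚ; ½)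
import Data.Rational.Properties as ℚ
open import Data.Rational.Solver using (module +-*-Solver)
import Data.Rational.Unnormalised.Base as ℚᵘ
import Data.Rational.Unnormalised.Properties as ℚᵘ
open import Data.Sum.Base using (_⊎_; inj₁; inj₂)
open import Function.Base using (_∘_)
open import Relation.Binary.Definitions using (DecidableEquality)
open import Relation.Binary.PropositionalEquality
  using (_≡_; _≢_; refl; sym; trans; cong; subst)
import Relation.Binary.Reasoning.Base.Single as SingleReasoning
open import Relation.Nullary.Decidable using (yes; no; dec-true; dec-false)
open import Relation.Nullary.Negation using (contradiction)

-- The order on the extended half-line

-- A record around _≤_, because x and y cannot be recovered from the unfolded x ≤ y.

infix 4 _≼_

record _≼_ (x y : ℝ≥0∞) : Set where
  constructor mk≼
  field below-⊆ : x ≤ y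

open _≼_

≼-refl : ∀ {x} → x ≼ x
≼-refl = mk≼ λ q<x → q<x

≼-reflexive : ∀ {x y} → x ≡ y → x ≼ y
≼-reflexive refl = ≼-refl

≼-trans : ∀ {x y z} → x ≼ y → y ≼ z → x ≼ z
≼-trans x≼y y≼z = mk≼ λ q<x → below-⊆ y≼z (below-⊆ x≼y q<x)

module ≼-Reasoning = SingleReasoning _≼_ ≼-refl ≼-trans

-- `below-closed` asks for a strict inequality; openness supplies the slack that covers `q ≡ r`.
below-≤ : ∀ x {q r} → q ℚ.≤ r → below x r → below x q
below-≤ x {q} {r} q≤r r<x =
  let s , r<s , s<x = below-open x r<x
  in  below-closed x (ℚ.≤-<-trans q≤r r<s) s<x

-- Every cut contains all negative rationals, so these need no check. This allows positivity to be
-- assumed when dividing by `ε`.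
nonNegative⇒≼ : ∀ {x y} → (∀ {q} → 0ℚ ℚ.≤ q → below x q → below y q) → x ≼ y
nonNegative⇒≼ {x} {y} h = mk≼ λ {q} → go q
  where
  go : ∀ q → below x q → below y q
  go q q<x with q ℚ.<? 0ℚ
  ... | yes q<0 = below-negative y q<0
  ... | no  q≮0 = h (ℚ.≮⇒≥ q≮0) q<x

0∞-least : ∀ {x} → 0∞ ≼ x
0∞-least {x} = mk≼ (below-negative x)

*-nonNeg : ∀ {p q} → 0ℚ ℚ.≤ p → 0ℚ ℚ.≤ q → 0ℚ ℚ.≤ p ℚ.* q
*-nonNeg {p} {q} 0≤p 0≤q =
  subst (ℚ._≤ p ℚ.* q) (ℚ.*-zeroˡ q) (ℚ.*-monoʳ-≤-nonNeg q {{ℚ.nonNegative 0≤q}} 0≤p)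

-- The operations are sealed: otherwise unification looks for x and y in x + y by
-- comparing cuts, which blows up.

infixl 6 _⊕_
infixl 7 _⊗_

opaque
  _⊕_ _⊗_ : ℝ≥0∞ → ℝ≥0∞ → ℝ≥0∞
  _⊕_ = _+_
  _⊗_ = _*_

  ⨁ : {A : Set} → (A → ℝ≥0∞) → ℝ≥0∞
  ⨁ = ∑

-- Addition on [0,+∞]

p+q<q : ∀ {p q} → p ℚ.< 0ℚ → p ℚ.+ q ℚ.< q
p+q<q {p} {q} p<0 = subst (p ℚ.+ q ℚ.<_) (ℚ.+-identityˡ q) (ℚ.+-monoˡ-< q p<0)

p+q<p : ∀ {p q} → q ℚ.< 0ℚ → p ℚ.+ q ℚ.< p
p+q<p {p} {q} q<0 = subst (p ℚ.+ q ℚ.<_) (ℚ.+-identityʳ p) (ℚ.+-monoʳ-< p q<0)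

opaque
  unfolding _⊕_

  +-below : ∀ x y {s t} → below x s → below y t → below (x ⊕ y) (s ℚ.+ t)
  +-below x y {s} {t} s<x t<y =
    let s′ , s<s′ , s′<x = below-open x s<x
    in  s′ , t , s′<x , t<y , ℚ.+-monoˡ-< t s<s′

  -- The witnesses of a sum may be negative, while those of a product may not. If one summand is
  -- negative, `q` is already below the other term; otherwise both are usable as factors.
  +-below⁻ : ∀ x y {q} → below (x ⊕ y) q →
    below x q ⊎ below y q ⊎
    ∃[ s ] ∃[ t ] (0ℚ ℚ.≤ s × 0ℚ ℚ.≤ t × below x s × below y t × q ℚ.< s ℚ.+ t)
  +-below⁻ x y (s , t , s<x , t<y , q<s+t) with s ℚ.<? 0ℚ | t ℚ.<? 0ℚ
  ... | yes s<0 | _       = inj₂ (inj₁ (below-closed y (ℚ.<-trans q<s+t (p+q<q s<0)) t<y))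
  ... | no  _   | yes t<0 = inj₁ (below-closed x (ℚ.<-trans q<s+t (p+q<p t<0)) s<x)
  ... | no  s≮0 | no  t≮0 = inj₂ (inj₂ (s , t , ℚ.≮⇒≥ s≮0 , ℚ.≮⇒≥ t≮0 , s<x , t<y , q<s+t))

  +-≼ : ∀ {x y z} → (∀ {s t} → below x s → below y t → below z (s ℚ.+ t)) → x ⊕ y ≼ z
  +-≼ {z = z} h = mk≼ λ where
    (s , t , s<x , t<y , q<s+t) → below-closed z q<s+t (h s<x t<y)

  x≼x+y : ∀ {x y} → x ≼ x ⊕ y
  x≼x+y {x} {y} = mk≼ λ {q} q<x →
    -- The second cut is only known to contain the negative rationals. The gap between `q` and `r`
    -- leaves room for a negative `s` with `q < r + s`.
    let r , q<r , r<x = below-open x q<x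
        q-r<0 = subst (q ℚ.- r ℚ.<_) (ℚ.+-inverseʳ r) (ℚ.+-monoˡ-< (ℚ.- r) q<r)
        s , q-r<s , s<0 = ℚ.<-dense q-r<0
    in  r , s , r<x , below-negative y s<0
      , subst (ℚ._< r ℚ.+ s) (solve 2 (λ q r → r :+ (q :- r) := q) refl q r)
          (ℚ.+-monoʳ-< r q-r<s)
    where open +-*-Solver

  +-comm : ∀ {x y} → x ⊕ y ≼ y ⊕ x
  +-comm = mk≼ λ {q} (s , t , s<x , t<y , q<s+t) →
    t , s , t<y , s<x , subst (q ℚ.<_) (ℚ.+-comm s t) q<s+t

  +-mono : ∀ {x x′ y y′} → x ≼ x′ → y ≼ y′ → x ⊕ y ≼ x′ ⊕ y′
  +-mono x≼x′ y≼y′ = mk≼ λ where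
    (s , t , s<x , t<y , q<s+t) → s , t , below-⊆ x≼x′ s<x , below-⊆ y≼y′ t<y , q<s+t

  +-identityʳ : ∀ {x} → x ⊕ 0∞ ≼ x
  +-identityʳ {x} = mk≼ λ where
    (s , t , s<x , t<0 , q<s+t) → below-closed x (ℚ.<-trans q<s+t (p+q<p t<0)) s<x

  +-assoc : ∀ {x y z} → (x ⊕ y) ⊕ z ≼ x ⊕ (y ⊕ z)
  +-assoc {x} {y} {z} = mk≼ λ {q} (s , t , (a , b , a<x , b<y , s<a+b) , t<z , q<s+t) →
    a , b ℚ.+ t , a<x , +-below y z b<y t<z
      , ℚ.<-trans q<s+t (subst (s ℚ.+ t ℚ.<_) (ℚ.+-assoc a b t) (ℚ.+-monoˡ-< t s<a+b))

y≼x+y : ∀ {x y} → y ≼ x ⊕ y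
y≼x+y {x} {y} = ≼-trans (x≼x+y {y} {x}) +-comm

+-monoˡ : ∀ {x x′ y} → x ≼ x′ → x ⊕ y ≼ x′ ⊕ y
+-monoˡ x≼x′ = +-mono x≼x′ ≼-refl

+-monoʳ : ∀ {x y y′} → y ≼ y′ → x ⊕ y ≼ x ⊕ y′
+-monoʳ y≼y′ = +-mono ≼-refl y≼y′

+-identityˡ : ∀ {x} → 0∞ ⊕ x ≼ x
+-identityˡ = ≼-trans +-comm +-identityʳ

+-left-comm : ∀ {x y z} → x ⊕ (y ⊕ z) ≼ y ⊕ (x ⊕ z)
+-left-comm {x} {y} {z} = begin
  x ⊕ (y ⊕ z) ∼⟨ +-comm ⟩
  (y ⊕ z) ⊕ x ∼⟨ +-assoc ⟩
  y ⊕ (z ⊕ x) ∼⟨ +-monoʳ +-comm ⟩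
  y ⊕ (x ⊕ z) ∎
  where open ≼-Reasoning

+-interchange : ∀ {w x y z} → (w ⊕ x) ⊕ (y ⊕ z) ≼ (w ⊕ y) ⊕ (x ⊕ z)
+-interchange {w} {x} {y} {z} = begin
  (w ⊕ x) ⊕ (y ⊕ z) ∼⟨ +-assoc ⟩
  w ⊕ (x ⊕ (y ⊕ z)) ∼⟨ +-monoʳ +-left-comm ⟩
  w ⊕ (y ⊕ (x ⊕ z)) ∼⟨ +-monoʳ +-comm ⟩
  w ⊕ ((x ⊕ z) ⊕ y) ∼⟨ +-comm ⟩
  ((x ⊕ z) ⊕ y) ⊕ w ∼⟨ +-assoc ⟩
  (x ⊕ z) ⊕ (y ⊕ w) ∼⟨ +-comm ⟩
  (y ⊕ w) ⊕ (x ⊕ z) ∼⟨ +-monoˡ +-comm ⟩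
  (w ⊕ y) ⊕ (x ⊕ z) ∎
  where open ≼-Reasoning

-- Multiplication on [0,+∞]

opaque
  unfolding _⊗_

  *-below : ∀ x y {s t} → 0ℚ ℚ.≤ s → 0ℚ ℚ.≤ t → below x s → below y t → below (x ⊗ y) (s ℚ.* t)
  *-below x y {s} {t} 0≤s 0≤t s<x t<y =
    -- Both factors are enlarged: `s * t ≤ s′ * t < s′ * t′`, the last step being strict because
    -- `s′` is positive.
    let s′ , s<s′ , s′<x = below-open x s<x
        t′ , t<t′ , t′<y = below-open y t<y
        0<s′ = ℚ.≤-<-trans 0≤s s<s′
    in  inj₂ (s′ , t′ , ℚ.<⇒≤ 0<s′ , ℚ.≤-trans 0≤t (ℚ.<⇒≤ t<t′) , s′<x , t′<y
        , ℚ.≤-<-trans (ℚ.*-monoʳ-≤-nonNeg t {{ℚ.nonNegative 0≤t}} (ℚ.<⇒≤ s<s′))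
                      (ℚ.*-monoʳ-<-pos s′ {{ℚ.positive 0<s′}} t<t′))

  *-below⁻ : ∀ x y {q} → 0ℚ ℚ.≤ q → below (x ⊗ y) q →
    ∃[ s ] ∃[ t ] (0ℚ ℚ.≤ s × 0ℚ ℚ.≤ t × below x s × below y t × q ℚ.< s ℚ.* t)
  *-below⁻ x y 0≤q (inj₁ q<0) = ⊥-elim (ℚ.<-irrefl refl (ℚ.≤-<-trans 0≤q q<0))
  *-below⁻ x y 0≤q (inj₂ w)   = w

  *-≼ : ∀ {x y z} →
    (∀ {s t} → 0ℚ ℚ.≤ s → 0ℚ ℚ.≤ t → below x s → below y t → below z (s ℚ.* t)) → x ⊗ y ≼ z
  *-≼ {z = z} h = mk≼ λ where
    (inj₁ q<0) → below-negative z q<0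
    (inj₂ (s , t , 0≤s , 0≤t , s<x , t<y , q<st)) → below-closed z q<st (h 0≤s 0≤t s<x t<y)

*-mono : ∀ {x x′ y y′} → x ≼ x′ → y ≼ y′ → x ⊗ y ≼ x′ ⊗ y′
*-mono {x} {x′} {y} {y′} x≼x′ y≼y′ = *-≼ {x} {y} {x′ ⊗ y′} λ 0≤s 0≤t s<x t<y →
  *-below x′ y′ 0≤s 0≤t (below-⊆ x≼x′ s<x) (below-⊆ y≼y′ t<y)

*-monoˡ : ∀ {x x′ y} → x ≼ x′ → x ⊗ y ≼ x′ ⊗ y
*-monoˡ x≼x′ = *-mono x≼x′ ≼-refl

*-monoʳ : ∀ {x y y′} → y ≼ y′ → x ⊗ y ≼ x ⊗ y′
*-monoʳ y≼y′ = *-mono ≼-refl y≼y′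

*-comm : ∀ {x y} → x ⊗ y ≼ y ⊗ x
*-comm {x} {y} = *-≼ {x} {y} {y ⊗ x} λ {s} {t} 0≤s 0≤t s<x t<y →
  subst (below (y ⊗ x)) (ℚ.*-comm t s) (*-below y x 0≤t 0≤s t<y s<x)

*-assoc : ∀ {x y z} → (x ⊗ y) ⊗ z ≼ x ⊗ (y ⊗ z)
*-assoc {x} {y} {z} = *-≼ {x ⊗ y} {z} {x ⊗ (y ⊗ z)} λ {s} {t} 0≤s 0≤t s<xy t<z →
  let a , b , 0≤a , 0≤b , a<x , b<y , s<ab = *-below⁻ x y 0≤s s<xy
  in  below-≤ (x ⊗ (y ⊗ z))
        (subst (s ℚ.* t ℚ.≤_) (ℚ.*-assoc a b t)
          (ℚ.*-monoʳ-≤-nonNeg t {{ℚ.nonNegative 0≤t}} (ℚ.<⇒≤ s<ab)))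
        (*-below x (y ⊗ z) 0≤a (*-nonNeg 0≤b 0≤t) a<x (*-below y z 0≤b 0≤t b<y t<z))

*-identityˡ : ∀ {x} → 1∞ ⊗ x ≼ x
*-identityˡ {x} = *-≼ {1∞} {x} {x} λ {s} {t} 0≤s 0≤t s<1 t<x →
  below-≤ x (subst (s ℚ.* t ℚ.≤_) (ℚ.*-identityˡ t)
    (ℚ.*-monoʳ-≤-nonNeg t {{ℚ.nonNegative 0≤t}} (ℚ.<⇒≤ s<1))) t<x

*-zeroˡ : ∀ {x y} → 0∞ ⊗ x ≼ y
*-zeroˡ {x} {y} = *-≼ {0∞} {x} {y} λ 0≤s _ s<0 _ → ⊥-elim (ℚ.<-irrefl refl (ℚ.≤-<-trans 0≤s s<0))

*-distribʳ-+ : ∀ {x y z} → (x ⊕ y) ⊗ z ≼ x ⊗ z ⊕ y ⊗ z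
*-distribʳ-+ {x} {y} {z} = *-≼ {x ⊕ y} {z} {x ⊗ z ⊕ y ⊗ z} go
  where
  go : ∀ {s t} → 0ℚ ℚ.≤ s → 0ℚ ℚ.≤ t → below (x ⊕ y) s → below z t →
       below (x ⊗ z ⊕ y ⊗ z) (s ℚ.* t)
  go {s} {t} 0≤s 0≤t s<x+y t<z with +-below⁻ x y s<x+y
  ... | inj₁ s<x        = below-⊆ x≼x+y (*-below x z 0≤s 0≤t s<x t<z)
  ... | inj₂ (inj₁ s<y) = below-⊆ (y≼x+y {x ⊗ z} {y ⊗ z}) (*-below y z 0≤s 0≤t s<y t<z)
  ... | inj₂ (inj₂ (a , b , 0≤a , 0≤b , a<x , b<y , s<a+b)) =
    below-≤ (x ⊗ z ⊕ y ⊗ z)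
      (subst (s ℚ.* t ℚ.≤_) (ℚ.*-distribʳ-+ t a b)
        (ℚ.*-monoʳ-≤-nonNeg t {{ℚ.nonNegative 0≤t}} (ℚ.<⇒≤ s<a+b)))
      (+-below (x ⊗ z) (y ⊗ z) (*-below x z 0≤a 0≤t a<x t<z) (*-below y z 0≤b 0≤t b<y t<z))

-- The two products come with different rationals `c` and `d` below `z`. Both are replaced by their
-- maximum, which is below `z` because it is one of the two.
*-factorʳ-+ : ∀ {x y z} → x ⊗ z ⊕ y ⊗ z ≼ (x ⊕ y) ⊗ z
*-factorʳ-+ {x} {y} {z} = mk≼ go
  where
  go : ∀ {q} → below (x ⊗ z ⊕ y ⊗ z) q → below ((x ⊕ y) ⊗ z) q
  go q<xz+yz with +-below⁻ (x ⊗ z) (y ⊗ z) q<xz+yz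
  ... | inj₁ q<xz        = below-⊆ (*-monoˡ {x} {x ⊕ y} {z} x≼x+y) q<xz
  ... | inj₂ (inj₁ q<yz) = below-⊆ (*-monoˡ {y} {x ⊕ y} {z} y≼x+y) q<yz
  ... | inj₂ (inj₂ (s , t , 0≤s , 0≤t , s<xz , t<yz , q<s+t)) =
    let a , c , 0≤a , 0≤c , a<x , c<z , s<ac = *-below⁻ x z 0≤s s<xz
        b , d , 0≤b , 0≤d , b<y , d<z , t<bd = *-below⁻ y z 0≤t t<yz
        m = c ℚ.⊔ d
        0≤m = ℚ.≤-trans 0≤c (ℚ.p≤p⊔q c d)
        m<z : below z m
        m<z = case⊔ (ℚ.⊔-sel c d) c<z d<z
        0≤a+b = subst (ℚ._≤ a ℚ.+ b) (ℚ.+-identityˡ 0ℚ) (ℚ.+-mono-≤ 0≤a 0≤b)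
        s+t≤ = ℚ.+-mono-≤
          (ℚ.≤-trans (ℚ.<⇒≤ s<ac) (ℚ.*-monoˡ-≤-nonNeg a {{ℚ.nonNegative 0≤a}} (ℚ.p≤p⊔q c d)))
          (ℚ.≤-trans (ℚ.<⇒≤ t<bd) (ℚ.*-monoˡ-≤-nonNeg b {{ℚ.nonNegative 0≤b}} (ℚ.p≤q⊔p c d)))
    in  below-closed ((x ⊕ y) ⊗ z)
          (ℚ.<-≤-trans q<s+t (subst (s ℚ.+ t ℚ.≤_) (sym (ℚ.*-distribʳ-+ m a b)) s+t≤))
          (*-below (x ⊕ y) z 0≤a+b 0≤m (+-below x y a<x b<y) m<z)
    where
    case⊔ : ∀ {c d m} → m ≡ c ⊎ m ≡ d → below z c → below z d → below z m
    case⊔ (inj₁ refl) c<z _ = c<z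
    case⊔ (inj₂ refl) _ d<z = d<z

*-factorˡ-+ : ∀ {x y z} → x ⊗ y ⊕ x ⊗ z ≼ x ⊗ (y ⊕ z)
*-factorˡ-+ {x} {y} {z} = begin
  x ⊗ y ⊕ x ⊗ z ∼⟨ +-mono *-comm *-comm ⟩
  y ⊗ x ⊕ z ⊗ x ∼⟨ *-factorʳ-+ ⟩
  (y ⊕ z) ⊗ x   ∼⟨ *-comm ⟩
  x ⊗ (y ⊕ z)   ∎
  where open ≼-Reasoning

-- Finite sums

module _ {A : Set} where

  sumOver : (A → ℝ≥0∞) → List A → ℝ≥0∞
  sumOver f xs = foldr _⊕_ 0∞ (map f xs)

  sumOver-mono : ∀ {f g : A → ℝ≥0∞} → (∀ a → f a ≼ g a) → ∀ xs → sumOver f xs ≼ sumOver g xs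
  sumOver-mono f≼g []       = ≼-refl
  sumOver-mono f≼g (x ∷ xs) = +-mono (f≼g x) (sumOver-mono f≼g xs)

  sumOver-split : ∀ {f g : A → ℝ≥0∞} xs → sumOver (λ a → f a ⊕ g a) xs ≼ sumOver f xs ⊕ sumOver g xs
  sumOver-split []       = x≼x+y
  sumOver-split (x ∷ xs) = ≼-trans (+-monoʳ (sumOver-split xs)) +-interchange

  sumOver-merge : ∀ {f g : A → ℝ≥0∞} xs → sumOver f xs ⊕ sumOver g xs ≼ sumOver (λ a → f a ⊕ g a) xs
  sumOver-merge []       = +-identityʳ
  sumOver-merge (x ∷ xs) = ≼-trans +-interchange (+-monoʳ (sumOver-merge xs))

  sumOver-*ʳ : ∀ {f : A → ℝ≥0∞} {y} xs → sumOver f xs ⊗ y ≼ sumOver (λ a → f a ⊗ y) xs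
  sumOver-*ʳ []       = *-zeroˡ
  sumOver-*ʳ (x ∷ xs) = ≼-trans *-distribʳ-+ (+-monoʳ (sumOver-*ʳ xs))

  sumOver-factorʳ : ∀ {f : A → ℝ≥0∞} {y} xs → sumOver (λ a → f a ⊗ y) xs ≼ sumOver f xs ⊗ y
  sumOver-factorʳ []       = 0∞-least
  sumOver-factorʳ (x ∷ xs) = ≼-trans (+-monoʳ (sumOver-factorʳ xs)) *-factorʳ-+

  sumOver-insert : ∀ {f : A → ℝ≥0∞} {x} ys {zs} →
    f x ⊕ sumOver f (ys ++ zs) ≼ sumOver f (ys ++ x ∷ zs)
  sumOver-insert []       = ≼-refl
  sumOver-insert (y ∷ ys) = ≼-trans +-left-comm (+-monoʳ (sumOver-insert ys))

  ∈-remove : ∀ {x z : A} ys {zs} → z ≢ x → z ∈ ys ++ x ∷ zs → z ∈ ys ++ zs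
  ∈-remove ys z≢x z∈ with ∈-++⁻ ys z∈
  ... | inj₁ z∈ys         = ∈-++⁺ˡ z∈ys
  ... | inj₂ (here z≡x)   = contradiction z≡x z≢x
  ... | inj₂ (there z∈zs) = ∈-++⁺ʳ ys z∈zs

  -- Each head of `xs` is cut out of `ys` at one occurrence. Uniqueness of `xs` keeps the tail
  -- inside what remains of `ys`.
  sumOver-⊆ : ∀ {f : A → ℝ≥0∞} {xs} → Unique xs → ∀ {ys} → (∀ {z} → z ∈ xs → z ∈ ys) →
    sumOver f xs ≼ sumOver f ys
  sumOver-⊆ []          _     = 0∞-least
  sumOver-⊆ {f} {x ∷ xs} (x≢ ∷ u) xs⊆ys with ∈-∃++ (xs⊆ys (here refl))
  ... | ps , qs , refl = ≼-trans
    (+-monoʳ {f x} (sumOver-⊆ u λ z∈xs →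
      ∈-remove ps (λ z≡x → All.lookup x≢ z∈xs (sym z≡x)) (xs⊆ys (there z∈xs))))
    (sumOver-insert {f} ps)

-- Infinite sums

module _ {A : Set} where

  opaque
    unfolding ⨁

    sumOver≡ : ∀ (f : A → ℝ≥0∞) xs → sumOver f xs ≡ finiteSum (map f xs)
    sumOver≡ f []       = refl
    sumOver≡ f (x ∷ xs) = cong (f x +_) (sumOver≡ f xs)

    ⨁-upper : ∀ {f : A → ℝ≥0∞} {xs} → Unique xs → sumOver f xs ≼ ⨁ f
    ⨁-upper {f} {xs} u = mk≼ λ {q} q<∑ → xs , u , subst (λ x → below x q) (sumOver≡ f xs) q<∑

    ⨁-below⁻ : ∀ (f : A → ℝ≥0∞) {q} → below (⨁ f) q → ∃[ xs ] (Unique xs × below (sumOver f xs) q)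
    ⨁-below⁻ f {q} (xs , u , q<∑) = xs , u , subst (λ x → below x q) (sym (sumOver≡ f xs)) q<∑

  ⨁-least : ∀ {f : A → ℝ≥0∞} {y} → (∀ {xs} → Unique xs → sumOver f xs ≼ y) → ⨁ f ≼ y
  ⨁-least {f} h = mk≼ λ q<∑ → let xs , u , q<xs = ⨁-below⁻ f q<∑ in below-⊆ (h u) q<xs

  ⨁-mono : ∀ {f g : A → ℝ≥0∞} → (∀ a → f a ≼ g a) → ⨁ f ≼ ⨁ g
  ⨁-mono f≼g = ⨁-least λ {xs} u → ≼-trans (sumOver-mono f≼g xs) (⨁-upper u)

  ⨁-split : ∀ {f g : A → ℝ≥0∞} → ⨁ (λ a → f a ⊕ g a) ≼ ⨁ f ⊕ ⨁ g
  ⨁-split = ⨁-least λ {xs} u → ≼-trans (sumOver-split xs) (+-mono (⨁-upper u) (⨁-upper u))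

  ⨁-*ʳ : ∀ {f : A → ℝ≥0∞} {y} → ⨁ f ⊗ y ≼ ⨁ (λ a → f a ⊗ y)
  ⨁-*ʳ {f} {y} = *-≼ λ 0≤s 0≤t s<∑ t<y →
    let xs , u , s<xs = ⨁-below⁻ f s<∑
    in  below-⊆ (≼-trans (sumOver-*ʳ xs) (⨁-upper u)) (*-below (sumOver f xs) y 0≤s 0≤t s<xs t<y)

  ⨁-factorʳ : ∀ {f : A → ℝ≥0∞} {y} → ⨁ (λ a → f a ⊗ y) ≼ ⨁ f ⊗ y
  ⨁-factorʳ = ⨁-least λ {xs} u → ≼-trans (sumOver-factorʳ xs) (*-monoˡ (⨁-upper u))

  ⨁-factorˡ : ∀ {f : A → ℝ≥0∞} {y} → ⨁ (λ a → y ⊗ f a) ≼ y ⊗ ⨁ f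
  ⨁-factorˡ = ≼-trans (⨁-mono λ _ → *-comm) (≼-trans ⨁-factorʳ *-comm)

module _ {A : Set} (_≟_ : DecidableEquality A) where

  -- The finite subsets approximating the two sums are both contained in their union. Decidable
  -- equality serves to list that union without duplicates.
  ⨁-merge : ∀ {f g : A → ℝ≥0∞} → ⨁ f ⊕ ⨁ g ≼ ⨁ (λ a → f a ⊕ g a)
  ⨁-merge {f} {g} = +-≼ λ s<∑f t<∑g →
    let xs , u , s<xs = ⨁-below⁻ f s<∑f
        ys , v , t<ys = ⨁-below⁻ g t<∑g
        zs            = deduplicate _≟_ (xs ++ ys)
        xs≼zs = sumOver-⊆ {f = f} u (∈-deduplicate⁺ _≟_ ∘ ∈-++⁺ˡ)
        ys≼zs = sumOver-⊆ {f = g} v (∈-deduplicate⁺ _≟_ ∘ ∈-++⁺ʳ xs)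
        zs≼⨁  = ⨁-upper (Unique.deduplicate-! _≟_ (xs ++ ys))
    in  below-⊆ (≼-trans (+-mono xs≼zs ys≼zs) (≼-trans (sumOver-merge zs) zs≼⨁))
          (+-below (sumOver f xs) (sumOver g ys) s<xs t<ys)

  sumOver-⨁ : ∀ {B : Set} (F : A → B → ℝ≥0∞) cs →
    sumOver (λ c → ⨁ λ b → F b c) cs ≼ ⨁ λ b → sumOver (F b) cs
  sumOver-⨁ F []       = 0∞-least
  sumOver-⨁ F (c ∷ cs) = ≼-trans (+-monoʳ (sumOver-⨁ F cs)) ⨁-merge

  -- One direction of Tonelli: a finite outer sum is moved inside by repeated use of `⨁-merge`, and
  -- then enlarged to the full sum for each `b`.
  ⨁-swap : ∀ {B : Set} (F : A → B → ℝ≥0∞) → ⨁ (λ c → ⨁ λ b → F b c) ≼ ⨁ λ b → ⨁ (F b)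
  ⨁-swap F = ⨁-least λ {cs} u → ≼-trans (sumOver-⨁ F cs) (⨁-mono λ b → ⨁-upper u)

  -- For a measure `σ`, a kernel `K` and a function `g`, this bounds the integral of `g` against
  -- `σK` by the integral of `Kg` against `σ`.
  ⨁-assoc : ∀ {B : Set} (σ : A → ℝ≥0∞) (K : A → B → ℝ≥0∞) (g : B → ℝ≥0∞) →
    ⨁ (λ c → ⨁ (λ b → σ b ⊗ K b c) ⊗ g c) ≼ ⨁ (λ b → σ b ⊗ ⨁ λ c → K b c ⊗ g c)
  ⨁-assoc σ K g = begin
    ⨁ (λ c → ⨁ (λ b → σ b ⊗ K b c) ⊗ g c)   ∼⟨ ⨁-mono (λ c → ⨁-*ʳ) ⟩
    ⨁ (λ c → ⨁ λ b → σ b ⊗ K b c ⊗ g c)     ∼⟨ ⨁-mono (λ c → ⨁-mono λ b → *-assoc) ⟩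
    ⨁ (λ c → ⨁ λ b → σ b ⊗ (K b c ⊗ g c))   ∼⟨ ⨁-swap (λ b c → σ b ⊗ (K b c ⊗ g c)) ⟩
    ⨁ (λ b → ⨁ λ c → σ b ⊗ (K b c ⊗ g c))   ∼⟨ ⨁-mono (λ b → ⨁-factorˡ) ⟩
    ⨁ (λ b → σ b ⊗ ⨁ λ c → K b c ⊗ g c)     ∎
    where open ≼-Reasoning

  ⨁-shift : ∀ (σ g : A → ℝ≥0∞) y →
    ⨁ σ ⊗ y ⊕ ⨁ (λ b → σ b ⊗ g b) ≼ ⨁ (λ b → σ b ⊗ (y ⊕ g b))
  ⨁-shift σ g y = begin
    ⨁ σ ⊗ y ⊕ ⨁ (λ b → σ b ⊗ g b)              ∼⟨ +-monoˡ ⨁-*ʳ ⟩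
    ⨁ (λ b → σ b ⊗ y) ⊕ ⨁ (λ b → σ b ⊗ g b)    ∼⟨ ⨁-merge ⟩
    ⨁ (λ b → σ b ⊗ y ⊕ σ b ⊗ g b)              ∼⟨ ⨁-mono (λ b → *-factorˡ-+) ⟩
    ⨁ (λ b → σ b ⊗ (y ⊕ g b))                  ∎
    where open ≼-Reasoning

-- Rational approximation of real numbers

-- Built directly as a reduced fraction with denominator 1, so that `archimedean` reduces to a
-- comparison of integers.
fromℕ : ℕ → ℚ
fromℕ n = ℚ.mkℚ (ℤ.+ n) 0 (Coprime.sym (Coprime.1-coprimeTo n))

fromℕ-suc : ∀ n → fromℕ (suc n) ≡ 1ℚ ℚ.+ fromℕ n
fromℕ-suc n = ℚ.toℚᵘ-injective (ℚᵘ.≃-trans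
  (ℚᵘ.*≡* (cong (λ k → (ℤ.+ 1 ℤ.+ k) ℤ.* ℤ.+ 1) (sym (ℤ.*-identityʳ (ℤ.+ n)))))
  (ℚᵘ.≃-sym (ℚ.toℚᵘ-homo-+ 1ℚ (fromℕ n))))

-- The absolute value of the numerator suffices, since the denominator is at least 1.
archimedean : ∀ p → ∃[ n ] p ℚ.≤ fromℕ n
archimedean (ℚ.mkℚ i d _) = ℤ.∣ i ∣ , ℚ.*≤* (ℤ.≤-trans
  (ℤ.≤-reflexive (ℤ.*-identityʳ i))
  (ℤ.≤-trans (i≤∣i∣ i) (ℤ.≤-trans
    (ℤ.+≤+ (ℕ.m≤m*n ℤ.∣ i ∣ (suc d)))
    (ℤ.≤-reflexive (ℤ.pos-* ℤ.∣ i ∣ (suc d))))))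
  where
  i≤∣i∣ : ∀ i → i ℤ.≤ ℤ.+ ℤ.∣ i ∣
  i≤∣i∣ (ℤ.+ n)    = ℤ.≤-refl
  i≤∣i∣ ℤ.-[1+ n ] = ℤ.-≤+

p<p+q : ∀ p {q} → 0ℚ ℚ.< q → p ℚ.< p ℚ.+ q
p<p+q p {q} 0<q = subst (ℚ._< p ℚ.+ q) (ℚ.+-identityʳ p) (ℚ.+-monoʳ-< p 0<q)

lower<upper : ∀ x {p q} → lower x p → upper x q → p ℚ.< q
lower<upper x {p} {q} p<x x<q with p ℚ.<? q
... | yes p<q = p<q
... | no  p≮q =
  let r , p<r , r<x = lower-open x p<x
  in  ⊥-elim (disjoint x (lower-closed x (ℚ.≤-<-trans (ℚ.≮⇒≥ p≮q) p<r) r<x) x<q)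

upper-≤ : ∀ x {q r} → q ℚ.≤ r → upper x q → upper x r
upper-≤ x q≤r x<q =
  let p , p<q , x<p = upper-open x x<q
  in  upper-closed x (ℚ.<-≤-trans p<q q≤r) x<p

p*q/q : ∀ p q .{{_ : ℚ.NonZero q}} → p ℚ.* ℚ.1/ q ℚ.* q ≡ p
p*q/q p q = trans (ℚ.*-assoc p (ℚ.1/ q) q) (trans (cong (p ℚ.*_) (ℚ.*-inverseˡ q)) (ℚ.*-identityʳ p))

module _ (x : ℝ) where

  -- Walk up from e in steps of δ; locatedness decides at each step whether to stop, and k
  -- bounds the number of steps left.
  approximate-from : ∀ {δ} → 0ℚ ℚ.< δ → ∀ k {e} → lower x e → upper x (e ℚ.+ fromℕ k ℚ.* δ) →
    ∃[ e′ ] (e ℚ.≤ e′ × lower x e′ × upper x (e′ ℚ.+ (δ ℚ.+ δ)))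
  approximate-from {δ} 0<δ zero {e} e<x x<e = ⊥-elim (disjoint x e<x
    (subst (upper x) (trans (cong (e ℚ.+_) (ℚ.*-zeroˡ δ)) (ℚ.+-identityʳ e)) x<e))
  approximate-from {δ} 0<δ (suc k) {e} e<x x<u
    with located x (ℚ.+-monoʳ-< e (p<p+q δ 0<δ))
  ... | inj₂ x<e+2δ = e , ℚ.≤-refl , e<x , x<e+2δ
  ... | inj₁ e+δ<x  =
    let e′ , e+δ≤e′ , e′<x , x<e′+2δ = approximate-from 0<δ k e+δ<x (subst (upper x) reassociate x<u)
    in  e′ , ℚ.≤-trans (ℚ.<⇒≤ (p<p+q e 0<δ)) e+δ≤e′ , e′<x , x<e′+2δ
    where
    reassociate : e ℚ.+ fromℕ (suc k) ℚ.* δ ≡ e ℚ.+ δ ℚ.+ fromℕ k ℚ.* δ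
    reassociate = trans (cong (λ n → e ℚ.+ n ℚ.* δ) (fromℕ-suc k))
      (solve 3 (λ e n δ → e :+ (con 1ℚ :+ n) :* δ := e :+ δ :+ n :* δ) refl e (fromℕ k) δ)
      where open +-*-Solver

  approximate : ∀ {δ} → 0ℚ ℚ.< δ → ∀ {e} → lower x e →
    ∃[ e′ ] (e ℚ.≤ e′ × lower x e′ × upper x (e′ ℚ.+ (δ ℚ.+ δ)))
  approximate {δ} 0<δ {e} e<x = approximate-from 0<δ k e<x (upper-≤ x u≤e+kδ x<u)
    where
    instance
      δ-positive : ℚ.Positive δ
      δ-positive = ℚ.positive 0<δ
      δ-nonNegative : ℚ.NonNegative δ
      δ-nonNegative = ℚ.pos⇒nonNeg δ
      δ-nonZero : ℚ.NonZero δ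
      δ-nonZero = ℚ.pos⇒nonZero δ
    u = proj₁ (upper-inhabited x)
    x<u = proj₂ (upper-inhabited x)
    -- At least `(u - e) / δ` steps of length `δ` lead from `e` to the upper bound `u` or beyond.
    k = proj₁ (archimedean ((u ℚ.- e) ℚ.* ℚ.1/ δ))
    u≤e+kδ : u ℚ.≤ e ℚ.+ fromℕ k ℚ.* δ
    u≤e+kδ = subst (ℚ._≤ e ℚ.+ fromℕ k ℚ.* δ)
      (trans (cong (e ℚ.+_) (p*q/q (u ℚ.- e) δ))
        (solve 2 (λ e u → e :+ (u :- e) := u) refl e u))
      (ℚ.+-monoʳ-≤ e (ℚ.*-monoʳ-≤-nonNeg δ (proj₂ (archimedean ((u ℚ.- e) ℚ.* ℚ.1/ δ)))))
      where open +-*-Solver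

  -- The walk starts at a fixed positive `e₀` below `x`, so the step `δ` can be chosen before `e` is
  -- known.
  approximate-ratio : Positive x → ∀ {r s} → 0ℚ ℚ.< r → r ℚ.< s →
    ∃[ e ] ∃[ u ] (0ℚ ℚ.≤ e × lower x e × upper x u × r ℚ.* u ℚ.≤ s ℚ.* e)
  approximate-ratio 0<x {r} {s} 0<r r<s =
    let e , e₀≤e , e<x , x<u = approximate 0<δ e₀<x
    in  e , e ℚ.+ (δ ℚ.+ δ) , ℚ.≤-trans (ℚ.<⇒≤ 0<e₀) e₀≤e , e<x , x<u , bound e₀≤e
    where
    open +-*-Solver
    e₀ = proj₁ (lower-open x 0<x)
    0<e₀ = proj₁ (proj₂ (lower-open x 0<x))
    e₀<x = proj₂ (proj₂ (lower-open x 0<x))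
    0<s-r : 0ℚ ℚ.< s ℚ.- r
    0<s-r = subst (ℚ._< s ℚ.- r) (ℚ.+-inverseʳ r) (ℚ.+-monoˡ-< (ℚ.- r) r<s)
    instance
      r-positive : ℚ.Positive r
      r-positive = ℚ.positive 0<r
      r-nonZero : ℚ.NonZero r
      r-nonZero = ℚ.pos⇒nonZero r
      r⁻¹-positive : ℚ.Positive (ℚ.1/ r)
      r⁻¹-positive = ℚ.1/pos⇒pos r
      e₀-positive : ℚ.Positive e₀
      e₀-positive = ℚ.positive 0<e₀
      s-r-positive : ℚ.Positive (s ℚ.- r)
      s-r-positive = ℚ.positive 0<s-r
    c = (s ℚ.- r) ℚ.* e₀
    -- Chosen so that `r * 2δ = (s - r) * e₀`. Then `r * (e + 2δ) = r * e + (s - r) * e₀`, which is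
    -- at most `s * e` as soon as `e₀ ≤ e`.
    δ = ½ ℚ.* (c ℚ.* ℚ.1/ r)
    0<δ : 0ℚ ℚ.< δ
    0<δ = ℚ.positive⁻¹ δ {{ℚ.pos*pos⇒pos ½ (c ℚ.* ℚ.1/ r)
            {{ℚ.pos*pos⇒pos c {{ℚ.pos*pos⇒pos (s ℚ.- r) e₀}} (ℚ.1/ r)}}}}
    bound : ∀ {e} → e₀ ℚ.≤ e → r ℚ.* (e ℚ.+ (δ ℚ.+ δ)) ℚ.≤ s ℚ.* e
    bound {e} e₀≤e = begin
      r ℚ.* (e ℚ.+ (δ ℚ.+ δ))
        ≡⟨ solve 3 (λ r e d → r :* (e :+ (con ½ :* d :+ con ½ :* d)) := r :* e :+ d :* r) refl
             r e (c ℚ.* ℚ.1/ r) ⟩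
      r ℚ.* e ℚ.+ c ℚ.* ℚ.1/ r ℚ.* r
        ≡⟨ cong (r ℚ.* e ℚ.+_) (p*q/q c r) ⟩
      r ℚ.* e ℚ.+ (s ℚ.- r) ℚ.* e₀
        ≤⟨ ℚ.+-monoʳ-≤ (r ℚ.* e) (ℚ.*-monoˡ-≤-nonNeg (s ℚ.- r) {{ℚ.pos⇒nonNeg (s ℚ.- r)}} e₀≤e) ⟩
      r ℚ.* e ℚ.+ (s ℚ.- r) ℚ.* e
        ≡⟨ solve 3 (λ r s e → r :* e :+ (s :- r) :* e := s :* e) refl r s e ⟩
      s ℚ.* e ∎
      where open ℚ.≤-Reasoning

-- The Lyapunov argument

module _ (𝒫 : FPARS) (L : FPARS.Lyapunov 𝒫) where

  open FPARS 𝒫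
  open Lyapunov L

  opaque
    unfolding _⊕_ ⨁

    -- This and the next three facts carry the hypotheses and definitions over to the sealed
    -- operations.
    total≼1 : ∀ (μ : Distribution Carrier) → ⨁ (mass μ) ≼ 1∞
    total≼1 μ = mk≼ (proj₁ (total μ))

    expected-V : ∀ {b μ} → P b ≡ just μ → ⨁ (λ c → V∞ c ⊗ mass μ c) ⊕ ε∞ ≼ V∞ b
    expected-V Pb≡μ = mk≼ (decrease Pb≡μ)

    ρ-suc : ∀ a i c → ρ a (suc i) c ≼ ⨁ (λ b → ρ a i b ⊗ ℙ[ b ⟶ c ])
    ρ-suc a i c = ≼-refl

    partialSum-suc : ∀ (σ : ℕ → Carrier → ℝ≥0∞) n →
      partialSum (λ i → ∣ σ i ∣) (suc n) ≼ partialSum (λ i → ∣ σ i ∣) n ⊕ ⨁ (σ n)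
    partialSum-suc σ n = ≼-refl

  -- If `b` is terminal, all its transition probabilities are 0 and so is the sum. Otherwise the sum
  -- splits into at most `ε` and the mean of `V`, which the Lyapunov condition bounds.
  expected-step : ∀ b → ⨁ (λ c → ℙ[ b ⟶ c ] ⊗ (ε∞ ⊕ V∞ c)) ≼ V∞ b
  expected-step b = go (P b) refl
    where
    open ≼-Reasoning
    -- `P b` is generalised to `m` so that `ℙ` computes by cases, while the equation is kept for
    -- `decrease`.
    go : ∀ m → P b ≡ m → ⨁ (λ c → maybe′ (λ μ → mass μ c) 0∞ m ⊗ (ε∞ ⊕ V∞ c)) ≼ V∞ b
    go nothing  _ = ≼-trans (⨁-mono λ c → *-zeroˡ) (⨁-least λ {xs} _ → vanish xs)
      where
      vanish : ∀ xs → sumOver (λ (_ : Carrier) → 0∞) xs ≼ V∞ b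
      vanish []       = 0∞-least
      vanish (c ∷ xs) = ≼-trans +-identityˡ (vanish xs)
    go (just μ) Pb≡μ = begin
      ⨁ (λ c → mass μ c ⊗ (ε∞ ⊕ V∞ c))                 ∼⟨ ⨁-mono (λ c → ≼-trans *-comm *-distribʳ-+) ⟩
      ⨁ (λ c → ε∞ ⊗ mass μ c ⊕ V∞ c ⊗ mass μ c)        ∼⟨ ⨁-split ⟩
      ⨁ (λ c → ε∞ ⊗ mass μ c) ⊕ V⟨μ⟩                   ∼⟨ +-monoˡ ⨁-factorˡ ⟩
      ε∞ ⊗ ⨁ (mass μ) ⊕ V⟨μ⟩                           ∼⟨ +-monoˡ (*-monoʳ (total≼1 μ)) ⟩
      ε∞ ⊗ 1∞ ⊕ V⟨μ⟩                                   ∼⟨ +-monoˡ (≼-trans *-comm *-identityˡ) ⟩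
      ε∞ ⊕ V⟨μ⟩                                        ∼⟨ +-comm ⟩
      V⟨μ⟩ ⊕ ε∞                                        ∼⟨ expected-V Pb≡μ ⟩
      V∞ b                                             ∎
      where
      V⟨μ⟩ : ℝ≥0∞
      V⟨μ⟩ = ⨁ (λ c → V∞ c ⊗ mass μ c)

  -- Telescoping along the computation from `a`

  module _ (a : Carrier) where

    potential : ℕ → ℝ≥0∞
    potential i = ⨁ (λ b → ρ a i b ⊗ V∞ b)

    private
      weighted-dirac : List Carrier → ℝ≥0∞
      weighted-dirac = sumOver (λ b → dirac a b ⊗ V∞ b)

    dirac-≡ : ∀ {b} → a ≡ b → dirac a b ≼ 1∞
    dirac-≡ {b} a≡b = ≼-reflexive (cong (if_then 1∞ else 0∞) (dec-true (a ≟ b) a≡b))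

    dirac-≢ : ∀ {b} → a ≢ b → dirac a b ≼ 0∞
    dirac-≢ {b} a≢b = ≼-reflexive (cong (if_then 1∞ else 0∞) (dec-false (a ≟ b) a≢b))

    weighted-dirac-≢ : ∀ {b y} → a ≢ b → dirac a b ⊗ V∞ b ≼ y
    weighted-dirac-≢ a≢b = ≼-trans (*-monoˡ (dirac-≢ a≢b)) *-zeroˡ

    ∉⇒weighted-dirac≼ : ∀ {y} xs → a ∉ xs → weighted-dirac xs ≼ y
    ∉⇒weighted-dirac≼ []       _    = 0∞-least
    ∉⇒weighted-dirac≼ (x ∷ xs) a∉xs = ≼-trans
      (+-mono (weighted-dirac-≢ (a∉xs ∘ here)) (∉⇒weighted-dirac≼ xs (a∉xs ∘ there))) +-identityˡ

    -- Only the entry `a` contributes, and it occurs at most once in a duplicate-free list.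
    weighted-dirac≼ : ∀ {xs} → Unique xs → weighted-dirac xs ≼ V∞ a
    weighted-dirac≼ [] = 0∞-least
    weighted-dirac≼ {x ∷ xs} (x≢ ∷ u) with a ≟ x
    ... | yes refl = ≼-trans
      (+-mono (≼-trans (*-monoˡ (dirac-≡ refl)) *-identityˡ)
              (∉⇒weighted-dirac≼ xs (Unique[x∷xs]⇒x∉xs (x≢ ∷ u)))) +-identityʳ
    ... | no  a≢x  = ≼-trans (+-mono (weighted-dirac-≢ a≢x) (weighted-dirac≼ u)) +-identityˡ

    potential-zero : potential 0 ≼ V∞ a
    potential-zero = ⨁-least weighted-dirac≼

    -- Mass and potential at time `i + 1` combine into one integral of `ε + V`. Moving the sum over
    -- predecessors `b` outside makes `expected-step` applicable term by term.
    potential-suc : ∀ i → ⨁ (ρ a (suc i)) ⊗ ε∞ ⊕ potential (suc i) ≼ potential i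
    potential-suc i = begin
      ⨁ (ρ a (suc i)) ⊗ ε∞ ⊕ potential (suc i)
        ∼⟨ ⨁-shift _≟_ (ρ a (suc i)) V∞ ε∞ ⟩
      ⨁ (λ c → ρ a (suc i) c ⊗ (ε∞ ⊕ V∞ c))
        ∼⟨ ⨁-mono (λ c → *-monoˡ (ρ-suc a i c)) ⟩
      ⨁ (λ c → ⨁ (λ b → ρ a i b ⊗ ℙ[ b ⟶ c ]) ⊗ (ε∞ ⊕ V∞ c))
        ∼⟨ ⨁-assoc _≟_ (ρ a i) ℙ[_⟶_] (λ c → ε∞ ⊕ V∞ c) ⟩
      ⨁ (λ b → ρ a i b ⊗ ⨁ λ c → ℙ[ b ⟶ c ] ⊗ (ε∞ ⊕ V∞ c))
        ∼⟨ ⨁-mono (λ b → *-monoʳ (expected-step b)) ⟩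
      potential i ∎
      where open ≼-Reasoning

    steps : ℕ → ℝ≥0∞
    steps = partialSum (λ i → ∣ ρ a (suc i) ∣)

    -- Keeping the remaining potential in the bound lets the induction telescope. `steps n` counts
    -- the masses at times 1 to `n`, so both terms refer to time `n`.
    steps+potential : ∀ n → steps n ⊗ ε∞ ⊕ potential n ≼ V∞ a
    steps+potential zero    = ≼-trans (+-mono *-zeroˡ potential-zero) +-identityˡ
    steps+potential (suc n) = begin
      steps (suc n) ⊗ ε∞ ⊕ potential (suc n)
        ∼⟨ +-monoˡ (*-monoˡ (partialSum-suc (ρ a ∘ suc) n)) ⟩
      (steps n ⊕ ⨁ (ρ a (suc n))) ⊗ ε∞ ⊕ potential (suc n)
        ∼⟨ +-monoˡ *-distribʳ-+ ⟩
      (steps n ⊗ ε∞ ⊕ ⨁ (ρ a (suc n)) ⊗ ε∞) ⊕ potential (suc n)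
        ∼⟨ +-assoc ⟩
      steps n ⊗ ε∞ ⊕ (⨁ (ρ a (suc n)) ⊗ ε∞ ⊕ potential (suc n))
        ∼⟨ +-monoʳ (potential-suc n) ⟩
      steps n ⊗ ε∞ ⊕ potential n
        ∼⟨ steps+potential n ⟩
      V∞ a ∎
      where open ≼-Reasoning

    steps*ε≼V : ∀ n → steps n ⊗ ε∞ ≼ V∞ a
    steps*ε≼V n = ≼-trans x≼x+y (steps+potential n)

    Steps≼V/ε : Steps a ≼ V∞ a / (ε , ε>0)
    Steps≼V/ε = nonNegative⇒≼ λ where
      0≤q (n , q<steps) →
        -- Openness is used twice: `q < r` is demanded by the definition of division, and `r < s` is
        -- the slack that absorbs the ratio `u / e`.
        let r , q<r , r<steps = below-open (steps n) q<steps
            s , r<s , s<steps = below-open (steps n) r<steps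
            0<r = ℚ.≤-<-trans 0≤q q<r
            0≤s = ℚ.<⇒≤ (ℚ.<-trans 0<r r<s)
            e , u , 0≤e , e<ε , ε<u , ru≤se = approximate-ratio ε ε>0 0<r r<s
        in  r , u , q<r , ε<u
          , below-≤ (V∞ a) ru≤se (below-⊆ (steps*ε≼V n) (*-below (steps n) ε∞ 0≤s 0≤e s<steps e<ε))

-- Finiteness of the bound and conclusion

NonNegative⇒0≤upper : ∀ x → NonNegative x → ∀ {q} → upper x q → 0ℚ ℚ.≤ q
NonNegative⇒0≤upper x 0≤x {q} x<q = ℚ.≮⇒≥ λ q<0 → disjoint x (0≤x q<0) x<q

-- A rational `w` above `x` and a positive rational `e` below `ε` give the bound `w / e`.
fromℝ/-finite : ∀ x (0≤x : NonNegative x) ε (0<ε : Positive ε) → Finite (fromℝ x 0≤x / (ε , 0<ε))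
fromℝ/-finite x 0≤x ε 0<ε = b , bound
  where
  e = proj₁ (lower-open ε 0<ε)
  e<ε = proj₂ (proj₂ (lower-open ε 0<ε))
  w = proj₁ (upper-inhabited x)
  x<w = proj₂ (upper-inhabited x)
  instance
    e-positive : ℚ.Positive e
    e-positive = ℚ.positive (proj₁ (proj₂ (lower-open ε 0<ε)))
    e-nonZero : ℚ.NonZero e
    e-nonZero = ℚ.pos⇒nonZero e
  b = w ℚ.* ℚ.1/ e
  0≤b : 0ℚ ℚ.≤ b
  0≤b = *-nonNeg (NonNegative⇒0≤upper x 0≤x x<w)
    (ℚ.<⇒≤ (ℚ.positive⁻¹ (ℚ.1/ e) {{ℚ.1/pos⇒pos e}}))
  bound : ∀ {q} → below (fromℝ x 0≤x / (ε , 0<ε)) q → q ℚ.< b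
  -- If `b < r`, then `w < r * e ≤ r * u < x < w`, which is absurd.
  bound (r , u , q<r , ε<u , ru<x) = ℚ.<-≤-trans q<r (ℚ.≮⇒≥ λ b<r →
    let w<re  = subst (ℚ._< r ℚ.* e) (p*q/q w e) (ℚ.*-monoˡ-<-pos e b<r)
        r≥0   = ℚ.nonNegative (ℚ.≤-trans 0≤b (ℚ.<⇒≤ b<r))
        re≤ru = ℚ.*-monoˡ-≤-nonNeg r {{r≥0}} (ℚ.<⇒≤ (lower<upper ε e<ε ε<u))
    in  ℚ.<-asym w<re (ℚ.≤-<-trans re≤ru (lower<upper x ru<x x<w)))

theorem3 : (𝒫 : FPARS) → let open FPARS 𝒫 in
    (L : Lyapunov) → let open Lyapunov L in
    PAST × (∀ a → Steps a ≤ V∞ a / (ε , ε>0))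
theorem3 𝒫 L = past , λ a → below-⊆ (Steps≼V/ε 𝒫 L a)
  where
  open FPARS 𝒫
  open Lyapunov L
  past : PAST
  past a =
    let b , V/ε<b = fromℝ/-finite (V a) (V≥0 a) ε ε>0
    in  b , λ q<Steps → V/ε<b (below-⊆ (Steps≼V/ε 𝒫 L a) q<Steps)
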